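{- Let $R$ be a commutative ring. Let $n$ be a positive integer and $p\in\mathbb{Z}$. Let $h_{k,\,i}$ be an element of $R$ for all $k\in\mathbb{Z}$ and $i\in[n]$. Assume that $$h_{k,\,n}=0\quad\text{for all }k<0.$$ For any $m\in\{0,1,\ldots,n\}$ and any $\lambda\in\mathbb{Z}^m$, define $$s_\lambda:=\det\left(\left(h_{\lambda_i+j-i,\,i}\right)_{i,j\in[m]}\right)\in R.$$ Fix an $n$-tuple $\mu\in\mathbb{Z}^n$ with $\mu_n=0$. Let $\overline{\mu}=(\mu_1,\mu_2,\ldots,\mu_{n-1})$. Then $$h_{p,\,n}\cdot s_{\overline{\mu}}=\sum_{\substack{\beta\in\mathbb{N}^n;\\ |\beta|=p}}s_{\mu+\beta}.$$
   Context: $\mathbb{N}=\{0,1,2,\ldots\}$ and $[m]=\{1,2,\ldots,m\}$. For a tuple $\alpha$, $\alpha_i$ denotes its $i$-th entry, and for $\alpha\in\mathbb{Z}^n$ we set $|\alpha|:=\alpha_1+\cdots+\alpha_n$. Addition of tuples is entrywise. $(a_{i,j})_{i,j\in[m]}$ denotes the $m\times m$-matrix with $(i,j)$-th entry $a_{i,j}$. -}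

module Defs where

open import Algebra.Bundles using (CommutativeRing)
import Algebra.Properties.CommutativeMonoid.Sum as Sum
import Algebra.Properties.Semiring.Exp as Exp
open import Data.Bool.Base using (if_then_else_)
open import Data.Fin.Base using (Fin; zero; suc; toℕ; inject≤; punchIn)
open import Data.Fin.Permutation as Perm using (Permutation′; _⟨$⟩ʳ_)
open import Data.Fin.Properties using (_<?_; punchIn-injective)
open import Data.Integer.Base as ℤ using (ℤ; +_; -[1+_])
open import Data.List.Base as List
  using (List; []; [_]; map; cartesianProductWith; concatMap; upTo; allFin)
open import Data.List.Membership.Propositional using (_∈_; lose; find)
open import Data.List.Membership.Propositional.Properties
  using (∈-map⁺; ∈-map⁻; ∈-concatMap⁺; ∈-concatMap⁻; ∈-upTo⁺; ∈-upTo⁻; ∈-allFin)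
open import Data.List.Relation.Binary.Disjoint.Propositional using (Disjoint)
import Data.List.Relation.Unary.All as All
import Data.List.Relation.Unary.All.Properties as All
open import Data.List.Relation.Unary.AllPairs as AllPairs using ([]; _∷_)
import Data.List.Relation.Unary.AllPairs.Properties as AllPairs
open import Data.List.Relation.Unary.Any using (Any; here)
import Data.List.Relation.Unary.Any.Properties as Any
import Data.List.Relation.Unary.Unique.Propositional as ≡
import Data.List.Relation.Unary.Unique.Propositional.Properties as ≡
import Data.List.Relation.Unary.Unique.Setoid as Setoid
import Data.List.Relation.Unary.Unique.Setoid.Properties as Setoid
open import Data.Nat.Base as ℕ using (ℕ; zero; suc; _∸_; _≤_)
import Data.Nat.Properties as ℕ
open import Data.Product.Base using (_×_; _,_)
open import Data.Vec.Base as Vec using (Vec; []; _∷_; lookup; zipWith)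
open import Data.Vec.Properties using (∷-injectiveʳ)
open import Function.Bundles using (_⇔_; mk⇔)
open import Function.Base using (_∘_)
open import Level using (0ℓ)
open import Relation.Binary.Bundles using (Setoid)
import Relation.Binary.Construct.On as On
open import Relation.Binary.PropositionalEquality
  using (_≡_; _≢_; refl; sym; trans; cong; setoid; _→-setoid_)
open import Relation.Nullary.Decidable using (does; _×-dec_)

-- Every permutation of Fin n, once each: σ is determined by k = σ(0) and by the
-- permutation that remains after deleting 0 from the domain and k from the codomain.
permutations : ∀ n → List (Permutation′ n)
permutations zero    = [ Perm.id ]
permutations (suc n) = cartesianProductWith (Perm.insert zero) (allFin (suc n)) (permutations n)

permutationSetoid : ℕ → Setoid 0ℓ 0ℓ
permutationSetoid n = On.setoid {B = Permutation′ n} (Fin n →-setoid Fin n) _⟨$⟩ʳ_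

permutations-complete : ∀ {n} (σ : Permutation′ n) → Any (Perm._≈ σ) (permutations n)
permutations-complete {zero}  σ = here λ ()
permutations-complete {suc n} σ =
  Any.cartesianProductWith⁺ (Perm.insert zero) step
    (∈-allFin (σ ⟨$⟩ʳ zero)) (permutations-complete (Perm.remove zero σ))
  where
  step : ∀ {k π} → σ ⟨$⟩ʳ zero ≡ k → π Perm.≈ Perm.remove zero σ →
         Perm.insert zero k π Perm.≈ σ
  step refl _   zero    = refl
  step refl π≈ (suc i) =
    trans (cong (punchIn (σ ⟨$⟩ʳ zero)) (π≈ i)) (Perm.insert-remove zero σ (suc i))

permutations-unique : ∀ n → Setoid.Unique (permutationSetoid n) (permutations n)
permutations-unique zero    = All.[] ∷ []
permutations-unique (suc n) =
  Setoid.cartesianProductWith⁺ (setoid (Fin (suc n))) (permutationSetoid n)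
    (permutationSetoid (suc n)) (Perm.insert zero)
    (λ {_} {_} {π} {ρ} → injective π ρ)
    (≡.allFin⁺ (suc n)) (permutations-unique n)
  where
  injective : ∀ {k l} (π ρ : Permutation′ n) →
              Perm.insert zero k π Perm.≈ Perm.insert zero l ρ → k ≡ l × π Perm.≈ ρ
  injective {k} π ρ eq with refl ← eq zero = refl , λ i → punchIn-injective k _ _ (eq (suc i))

inversions : ∀ {n} → Permutation′ n → ℕ
inversions {n} σ =
  ∑[ i < n ] ∑[ j < n ] (if does (i <? j ×-dec (σ ⟨$⟩ʳ j) <? (σ ⟨$⟩ʳ i)) then 1 else 0)
  where open Sum ℕ.+-0-commutativeMonoid using (sum-syntax)

-- The tuples β ∈ ℕⁿ with β₁ + ⋯ + βₙ = p, once each.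
weakCompositions : ∀ n → ℕ → List (Vec ℕ n)
weakCompositions zero    zero    = [ [] ]
weakCompositions zero    (suc _) = []
weakCompositions (suc n) p       =
  concatMap (λ b → map (b ∷_) (weakCompositions n (p ∸ b))) (upTo (suc p))

weakCompositionsℤ : ∀ n → ℤ → List (Vec ℕ n)
weakCompositionsℤ n (+ p)    = weakCompositions n p
weakCompositionsℤ n -[1+ _ ] = []

∈-weakCompositions⁻ : ∀ {n} p {β : Vec ℕ n} → β ∈ weakCompositions n p → Vec.sum β ≡ p
∈-weakCompositions⁻ {zero}  zero (here refl) = refl
∈-weakCompositions⁻ {suc n} p β∈
  with b , b∈ , β∈′ ← find (∈-concatMap⁻ _ {xs = upTo (suc p)} β∈)
  with _ , γ∈ , refl ← ∈-map⁻ (b ∷_) β∈′ =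
  trans (cong (b ℕ.+_) (∈-weakCompositions⁻ (p ∸ b) γ∈))
        (ℕ.m+[n∸m]≡n (ℕ.s≤s⁻¹ (∈-upTo⁻ b∈)))

∈-weakCompositions⁺ : ∀ {n} (β : Vec ℕ n) → β ∈ weakCompositions n (Vec.sum β)
∈-weakCompositions⁺ []      = here refl
∈-weakCompositions⁺ {suc n} (b ∷ γ) =
  ∈-concatMap⁺ _ (lose (∈-upTo⁺ (ℕ.s≤s (ℕ.m≤m+n b _))) (∈-map⁺ (b ∷_) γ∈))
  where
  γ∈ : γ ∈ weakCompositions n (b ℕ.+ Vec.sum γ ∸ b)
  γ∈ rewrite ℕ.m+n∸m≡n b (Vec.sum γ) = ∈-weakCompositions⁺ γ

∈-weakCompositionsℤ : ∀ {n p} {β : Vec ℕ n} → β ∈ weakCompositionsℤ n p ⇔ + Vec.sum β ≡ p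
∈-weakCompositionsℤ {n} {p} {β} = mk⇔ (to p) λ where refl → ∈-weakCompositions⁺ β
  where
  to : ∀ p → β ∈ weakCompositionsℤ n p → + Vec.sum β ≡ p
  to (+ p) = cong +_ ∘ ∈-weakCompositions⁻ p

weakCompositions-unique : ∀ n p → ≡.Unique (weakCompositions n p)
weakCompositions-unique zero    zero    = All.[] ∷ []
weakCompositions-unique zero    (suc _) = []
weakCompositions-unique (suc n) p       =
  ≡.concat⁺
    (All.map⁺ (All.tabulate λ {b} _ → ≡.map⁺ ∷-injectiveʳ (weakCompositions-unique n (p ∸ b))))
    (AllPairs.map⁺ (AllPairs.map disjoint (≡.upTo⁺ (suc p))))
  where
  disjoint : ∀ {b c γs δs} → b ≢ c → Disjoint (map (b ∷_) γs) (map (c ∷_) δs)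
  disjoint b≢c (β∈ , β∈′) with _ , _ , refl ← ∈-map⁻ _ β∈ | _ , _ , refl ← ∈-map⁻ _ β∈′ = b≢c refl

weakCompositionsℤ-unique : ∀ n p → ≡.Unique (weakCompositionsℤ n p)
weakCompositionsℤ-unique n (+ p)    = weakCompositions-unique n p
weakCompositionsℤ-unique n -[1+ _ ] = []

_⊕_ : ∀ {n} → Vec ℤ n → Vec ℕ n → Vec ℤ n
_⊕_ = zipWith (λ a b → a ℤ.+ (+ b))

module OverRing {c ℓ} (R : CommutativeRing c ℓ) where
  open CommutativeRing R
  open Exp semiring using (_^_)
  open Sum *-commutativeMonoid public using () renaming (sum to ∏)

  sumOver : ∀ {a} {A : Set a} → List A → (A → Carrier) → Carrier
  sumOver xs f = List.foldr _+_ 0# (map f xs)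

  syntax sumOver xs (λ x → e) = ∑[ x ∈ xs ] e

  sign : ∀ {n} → Permutation′ n → Carrier
  sign σ = (- 1#) ^ inversions σ

  det : ∀ {n} → (Fin n → Fin n → Carrier) → Carrier
  det {n} A = ∑[ σ ∈ permutations n ] (sign σ * ∏ (λ i → A i (σ ⟨$⟩ʳ i)))

  -- Rows and columns are numbered from 0 rather than 1, which leaves j - i unchanged.
  s : ∀ {n} → (ℤ → Fin n → Carrier) → ∀ {m} → m ≤ n → Vec ℤ m → Carrier
  s h m≤n λs =
    det (λ i j → h (lookup λs i ℤ.+ (+ toℕ j) ℤ.- (+ toℕ i)) (inject≤ i m≤n))

{-# OPTIONS --safe #-}

-- With indices from 0, put f i k = h (μ i + k - i) i and let F be the n × n matrix over R[[t]]
-- with entries F i j = Σ_b f i (j + b) t^b.  By multilinearity in the rows, the coefficient of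
-- t^p in det F is the right-hand side.  Now F i j = f i j + t · F i (j + 1), so subtracting t
-- times the next column from each column but the last turns these into constants f i j without
-- changing the determinant.  The last row is then (0, …, 0, Σ_b h b (n - 1) t^b), and its
-- last entry has the constant s of the truncated μ as cofactor.
module Submission where

open import Algebra.Bundles using (CommutativeRing; AbelianGroup)
import Algebra.Consequences.Setoid as Consequences
import Algebra.Construct.Pointwise as Pointwise
import Algebra.Properties.CommutativeMonoid.Sum as Sum
import Algebra.Properties.CommutativeSemigroup as CommutativeSemigroup
import Algebra.Properties.Ring as RingProperties
import Algebra.Properties.Semiring.Exp as Exp
open import Data.Bool.Base using (if_then_else_; _∧_)
open import Data.Fin.Base using (Fin; zero; suc; toℕ; fromℕ; fromℕ<; inject₁; inject≤; punchIn; punchOut)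
open import Data.Fin.Permutation as Perm using (Permutation′; _⟨$⟩ʳ_)
open import Data.Fin.Properties
  using (_≟_; _<?_; punchIn-injective; punchInᵢ≢i; punchIn-punchOut; toℕ-inject₁; toℕ-fromℕ;
         toℕ-injective; toℕ-fromℕ<; toℕ<n; inject≤-refl; suc-injective)
open import Data.Integer.Base as ℤ using (ℤ; 0ℤ; _<_; +_; -[1+_])
import Data.Integer.Properties as ℤ
import Data.Integer.Tactic.RingSolver as ℤSolver
open import Data.List.Base as List
  using (List; []; _∷_; _++_; map; concatMap; cartesianProductWith; upTo; applyUpTo; allFin; tabulate)
open import Data.List.Properties using (map-∘; map-tabulate; map-upTo)
open import Data.Nat.Base as ℕ using (ℕ; zero; suc; _∸_)
open import Data.Nat.Properties as ℕ using (≤-refl; n≤1+n)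
open import Data.Product.Base using (_×_; _,_; ∃)
open import Data.Sum.Base using (_⊎_; inj₁; inj₂)
open import Data.Vec.Base using (Vec; []; _∷_; init; last; lookup)
open import Data.Vec.Functional using (updateAt)
open import Data.Vec.Functional.Properties using (updateAt-updates; updateAt-minimal)
open import Data.Vec.Properties using (lookup-zipWith)
open import Function.Base using (_∘_; id; const; _$_)
open import Relation.Binary.PropositionalEquality as ≡ using (_≡_; _≢_)
import Relation.Binary.Reasoning.Setoid as ≈-Reasoning
open import Relation.Nullary.Decidable using (does; yes; no)
open import Relation.Nullary.Negation using (contradiction)
open import Defs

-- Inversions of a permutation extended by insertion.

punchIn-does-< : ∀ {n} (k : Fin (suc n)) i j →
                 does (punchIn k i <? punchIn k j) ≡ does (i <? j)
punchIn-does-< zero    _       _       = ≡.refl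
punchIn-does-< (suc k) zero    zero    = ≡.refl
punchIn-does-< (suc k) zero    (suc j) = ≡.refl
punchIn-does-< (suc k) (suc i) zero    = ≡.refl
punchIn-does-< (suc k) (suc i) (suc j) = punchIn-does-< k i j

module _ where
  open Sum ℕ.+-0-commutativeMonoid using (sum; sum-cong-≗; sum-permute; sum-replicate-zero)

  count-punchIn< : ∀ {n} (k : Fin (suc n)) →
                   sum (λ j → if does (punchIn k j <? k) then 1 else 0) ≡ toℕ k
  count-punchIn< {n}     zero    = sum-replicate-zero n
  count-punchIn< {suc n} (suc k) = ≡.cong suc (count-punchIn< k)

  -- Position 0 takes the value k and forms an inversion with each position of smaller value; there
  -- are k such values, in whatever order π lists them. Among the other positions nothing changes,
  -- because `punchIn k` preserves order.
  inversions-insert : ∀ {n} (k : Fin (suc n)) (π : Permutation′ n) →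
                      inversions (Perm.insert zero k π) ≡ toℕ k ℕ.+ inversions π
  inversions-insert {n} k π = ≡.cong₂ ℕ._+_
    (≡.trans (≡.sym (sum-permute _ π)) (count-punchIn< k))
    (sum-cong-≗ {n} {λ i → sum {n} (inverted (punchIn k) i)} {λ i → sum {n} (inverted id i)} λ i →
     sum-cong-≗ {n} {inverted (punchIn k) i} {inverted id i} λ j →
      ≡.cong (λ b → if does (i <? j) ∧ b then 1 else 0)
        (punchIn-does-< k (π ⟨$⟩ʳ j) (π ⟨$⟩ʳ i)))
    where
    inverted : ∀ {m} → (Fin n → Fin m) → Fin n → Fin n → ℕ
    inverted φ i j = if does (i <? j) ∧ does (φ (π ⟨$⟩ʳ j) <? φ (π ⟨$⟩ʳ i)) then 1 else 0

-- Positions of columns after deletion and replacement.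

inject₁≢suc : ∀ {n} (c : Fin n) → inject₁ c ≢ suc c
inject₁≢suc zero    ()
inject₁≢suc (suc c) eq = inject₁≢suc c (suc-injective eq)

-- The lists of columns left after deleting c or c + 1 differ in one slot only, which holds c + 1 in
-- the first list and c in the second. Hence the two minors agree when these columns are equal.
punchIn-adjacent : ∀ {n} (c j : Fin n) →
                   punchIn (inject₁ c) j ≡ punchIn (suc c) j ⊎
                   (punchIn (inject₁ c) j ≡ suc c × punchIn (suc c) j ≡ inject₁ c)
punchIn-adjacent zero    zero    = inj₂ (≡.refl , ≡.refl)
punchIn-adjacent zero    (suc j) = inj₁ ≡.refl
punchIn-adjacent (suc c) zero    = inj₁ ≡.refl
punchIn-adjacent (suc c) (suc j) with punchIn-adjacent c j
... | inj₁ eq       = inj₁ (≡.cong suc eq)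
... | inj₂ (p , q)  = inj₂ (≡.cong suc p , ≡.cong suc q)

-- Deleting a third column cannot separate two neighbours. This lets equality of adjacent columns
-- pass to the minors.
punchIn-adjacent⁻ : ∀ {n} (c : Fin (suc n)) k → k ≢ inject₁ c → k ≢ suc c →
                    ∃ λ c′ → punchIn k (inject₁ c′) ≡ inject₁ c × punchIn k (suc c′) ≡ suc c
punchIn-adjacent⁻ zero            zero            k≢c _    = contradiction ≡.refl k≢c
punchIn-adjacent⁻ (suc c)         zero            _   _    = c , ≡.refl , ≡.refl
punchIn-adjacent⁻ zero            (suc zero)      _   k≢1+c = contradiction ≡.refl k≢1+c
punchIn-adjacent⁻ {suc n} zero    (suc (suc k))   _   _    = zero , ≡.refl , ≡.refl
punchIn-adjacent⁻ {suc n} (suc c) (suc k)         k≢c k≢1+c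
  with c′ , p , q ← punchIn-adjacent⁻ c k (k≢c ∘ ≡.cong suc) (k≢1+c ∘ ≡.cong suc)
  = suc c′ , ≡.cong suc p , ≡.cong suc q

punchIn-inject₁ : ∀ {n} (k : Fin (suc n)) j → punchIn (inject₁ k) (inject₁ j) ≡ inject₁ (punchIn k j)
punchIn-inject₁ zero    j       = ≡.refl
punchIn-inject₁ (suc k) zero    = ≡.refl
punchIn-inject₁ (suc k) (suc j) = ≡.cong suc (punchIn-inject₁ k j)

punchIn-inject₁-fromℕ : ∀ {n} (k : Fin (suc n)) → punchIn (inject₁ k) (fromℕ n) ≡ fromℕ (suc n)
punchIn-inject₁-fromℕ         zero    = ≡.refl
punchIn-inject₁-fromℕ {suc n} (suc k) = ≡.cong suc (punchIn-inject₁-fromℕ k)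

punchIn-fromℕ : ∀ {n} (j : Fin n) → punchIn (fromℕ n) j ≡ inject₁ j
punchIn-fromℕ zero    = ≡.refl
punchIn-fromℕ (suc j) = ≡.cong suc (punchIn-fromℕ j)

-- mixed u v k lists u 0, …, u (k - 1), v k, v (k + 1), …
mixed : ∀ {a} {A : Set a} → (ℕ → A) → (ℕ → A) → ℕ → ℕ → A
mixed u v zero    j       = v j
mixed u v (suc k) zero    = u zero
mixed u v (suc k) (suc j) = mixed (u ∘ suc) (v ∘ suc) k j

module _ {a} {A : Set a} where

  mixed-diagonal : ∀ (u v : ℕ → A) k → mixed u v k k ≡ v k
  mixed-diagonal u v zero    = ≡.refl
  mixed-diagonal u v (suc k) = mixed-diagonal (u ∘ suc) (v ∘ suc) k

  mixed-suc-diagonal : ∀ (u v : ℕ → A) k → mixed u v (suc k) k ≡ u k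
  mixed-suc-diagonal u v zero    = ≡.refl
  mixed-suc-diagonal u v (suc k) = mixed-suc-diagonal (u ∘ suc) (v ∘ suc) k

  mixed-suc : ∀ (u v : ℕ → A) k j → j ≢ k → mixed u v k j ≡ mixed u v (suc k) j
  mixed-suc u v zero    zero    j≢k = contradiction ≡.refl j≢k
  mixed-suc u v zero    (suc j) j≢k = ≡.refl
  mixed-suc u v (suc k) zero    j≢k = ≡.refl
  mixed-suc u v (suc k) (suc j) j≢k = mixed-suc (u ∘ suc) (v ∘ suc) k j (j≢k ∘ ≡.cong suc)

  mixed-< : ∀ (u v : ℕ → A) {k} (j : Fin k) → mixed u v k (toℕ j) ≡ u (toℕ j)
  mixed-< u v zero    = ≡.refl
  mixed-< u v (suc j) = mixed-< (u ∘ suc) (v ∘ suc) j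

-- Determinants by expansion along the first row.

module Laplace {c ℓ} (R : CommutativeRing c ℓ) where
  open CommutativeRing R hiding (zero)
  open RingProperties ring using (-0#≈0#; x[y-z]≈xy-xz; -‿+-comm)
  open CommutativeSemigroup +-commutativeSemigroup using (interchange)
  open CommutativeSemigroup *-commutativeSemigroup using (x∙yz≈y∙xz)
  open ≈-Reasoning setoid

  -- Nested subtraction produces the signs of a Laplace expansion without powers of -1, so that
  -- proofs go by structural induction.
  alternatingSum : ∀ {n} → (Fin n → Carrier) → Carrier
  alternatingSum {zero}  f = 0#
  alternatingSum {suc n} f = f zero - alternatingSum (f ∘ suc)

  alternatingSum-cong : ∀ {n} {f g : Fin n → Carrier} → (∀ k → f k ≈ g k) →
                        alternatingSum f ≈ alternatingSum g
  alternatingSum-cong {zero}  f≈g = refl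
  alternatingSum-cong {suc n} f≈g = +-cong (f≈g zero) (-‿cong (alternatingSum-cong (f≈g ∘ suc)))

  alternatingSum-0 : ∀ {n} {f : Fin n → Carrier} → (∀ k → f k ≈ 0#) → alternatingSum f ≈ 0#
  alternatingSum-0 {zero}  f≈0 = refl
  alternatingSum-0 {suc n} f≈0 =
    trans (+-cong (f≈0 zero) (-‿cong (alternatingSum-0 (f≈0 ∘ suc)))) (-‿inverseʳ 0#)

  alternatingSum-+ : ∀ {n} (f g : Fin n → Carrier) →
                     alternatingSum (λ k → f k + g k) ≈ alternatingSum f + alternatingSum g
  alternatingSum-+ {zero}  f g = sym (+-identityˡ 0#)
  alternatingSum-+ {suc n} f g = begin
    f zero + g zero - alternatingSum (λ k → f (suc k) + g (suc k))
      ≈⟨ +-congˡ (-‿cong (alternatingSum-+ (f ∘ suc) (g ∘ suc))) ⟩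
    f zero + g zero - (alternatingSum (f ∘ suc) + alternatingSum (g ∘ suc))
      ≈⟨ +-congˡ (-‿+-comm _ _) ⟨
    f zero + g zero + (- alternatingSum (f ∘ suc) + - alternatingSum (g ∘ suc))
      ≈⟨ interchange _ _ _ _ ⟩
    alternatingSum f + alternatingSum g ∎

  alternatingSum-* : ∀ {n} t (f : Fin n → Carrier) →
                     t * alternatingSum f ≈ alternatingSum (λ k → t * f k)
  alternatingSum-* {zero}  t f = zeroʳ t
  alternatingSum-* {suc n} t f =
    trans (x[y-z]≈xy-xz t _ _) (+-congˡ (-‿cong (alternatingSum-* t (f ∘ suc))))

  -- Neighbouring terms carry opposite signs, so the only two that may be nonzero cancel.
  alternatingSum-adjacent : ∀ {n} (c : Fin n) {f : Fin (suc n) → Carrier} →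
                            f (inject₁ c) ≈ f (suc c) →
                            (∀ k → k ≢ inject₁ c → k ≢ suc c → f k ≈ 0#) →
                            alternatingSum f ≈ 0#
  alternatingSum-adjacent zero {f} eq f≈0 = begin
    f zero - (f (suc zero) - alternatingSum (λ k → f (suc (suc k))))
      ≈⟨ +-congˡ (-‿cong (+-congˡ (trans (-‿cong
           (alternatingSum-0 λ k → f≈0 (suc (suc k)) (λ ()) (λ ()))) -0#≈0#))) ⟩
    f zero - (f (suc zero) + 0#)  ≈⟨ +-congˡ (-‿cong (+-identityʳ _)) ⟩
    f zero - f (suc zero)         ≈⟨ +-congʳ eq ⟩
    f (suc zero) - f (suc zero)   ≈⟨ -‿inverseʳ _ ⟩
    0#                            ∎
  alternatingSum-adjacent (suc c) eq f≈0 =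
    trans (+-cong (f≈0 zero (λ ()) (λ ()))
                  (-‿cong (alternatingSum-adjacent c eq λ k p q →
                    f≈0 (suc k) (p ∘ suc-injective) (q ∘ suc-injective))))
          (-‿inverseʳ 0#)

  alternatingSum-init : ∀ {n} {f : Fin (suc n) → Carrier} → f (fromℕ n) ≈ 0# →
                        alternatingSum f ≈ alternatingSum (f ∘ inject₁)
  alternatingSum-init {zero}  f≈0 = trans (+-cong f≈0 -0#≈0#) (+-identityʳ 0#)
  alternatingSum-init {suc n} {f} f≈0 = +-congˡ (-‿cong (alternatingSum-init {f = f ∘ suc} f≈0))

  minor : ∀ {n} → (Fin (suc n) → Fin (suc n) → Carrier) → Fin (suc n) → Fin n → Fin n → Carrier
  minor A k i j = A (suc i) (punchIn k j)

  laplace : ∀ {n} → (Fin n → Fin n → Carrier) → Carrier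
  laplace {zero}  A = 1#
  laplace {suc n} A = alternatingSum λ k → A zero k * laplace (minor A k)

  summand : ∀ {n} → (Fin (suc n) → Fin (suc n) → Carrier) → Fin (suc n) → Carrier
  summand A k = A zero k * laplace (minor A k)

  laplace-cong : ∀ {n} {A B : Fin n → Fin n → Carrier} → (∀ i j → A i j ≈ B i j) →
                 laplace A ≈ laplace B
  laplace-cong {zero}  A≈B = refl
  laplace-cong {suc n} A≈B = alternatingSum-cong λ k →
    *-cong (A≈B zero k) (laplace-cong λ i j → A≈B (suc i) (punchIn k j))

  -- In the term for k = c the entry splits, and the minor, which lacks column c, is common to all
  -- three matrices. In every other term the entry is common and the minor splits by induction.
  -- Relating the matrices entry by entry makes the hypotheses pass to minors directly.
  laplace-linear : ∀ {n} (c : Fin n) t {A B C : Fin n → Fin n → Carrier} →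
                   (∀ i → A i c ≈ B i c + t * C i c) →
                   (∀ i j → j ≢ c → A i j ≈ B i j) →
                   (∀ i j → j ≢ c → A i j ≈ C i j) →
                   laplace A ≈ laplace B + t * laplace C
  laplace-linear {suc n} c t {A} {B} {C} A≈B+tC A≈B A≈C = begin
    alternatingSum (summand A)
      ≈⟨ alternatingSum-cong term ⟩
    alternatingSum (λ k → summand B k + t * summand C k)
      ≈⟨ alternatingSum-+ (summand B) (λ k → t * summand C k) ⟩
    laplace B + alternatingSum (λ k → t * summand C k)
      ≈⟨ +-congˡ (alternatingSum-* t (summand C)) ⟨
    laplace B + t * laplace C ∎
    where
    term : ∀ k → summand A k ≈ summand B k + t * summand C k
    term k with k ≟ c
    ... | yes ≡.refl = begin
      A zero k * laplace (minor A k)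
        ≈⟨ *-congʳ (A≈B+tC zero) ⟩
      (B zero k + t * C zero k) * laplace (minor A k)
        ≈⟨ distribʳ _ _ _ ⟩
      B zero k * laplace (minor A k) + t * C zero k * laplace (minor A k)
        ≈⟨ +-cong (*-congˡ (laplace-cong λ i j → A≈B (suc i) _ (punchInᵢ≢i k j)))
                  (trans (*-assoc _ _ _)
                    (*-congˡ (*-congˡ (laplace-cong λ i j → A≈C (suc i) _ (punchInᵢ≢i k j))))) ⟩
      B zero k * laplace (minor B k) + t * (C zero k * laplace (minor C k)) ∎
    ... | no k≢c = begin
      A zero k * laplace (minor A k)
        -- `punchOut k≢c` is where column c sits once column k is gone.
        ≈⟨ *-congˡ (laplace-linear (punchOut k≢c) t
             (λ i → ≡.subst (λ d → A (suc i) d ≈ B (suc i) d + t * C (suc i) d)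
                            (≡.sym (punchIn-punchOut k≢c)) (A≈B+tC (suc i)))
             (λ i j j≢ → A≈B (suc i) _ (avoids j j≢))
             (λ i j j≢ → A≈C (suc i) _ (avoids j j≢))) ⟩
      A zero k * (laplace (minor B k) + t * laplace (minor C k))
        ≈⟨ distribˡ _ _ _ ⟩
      A zero k * laplace (minor B k) + A zero k * (t * laplace (minor C k))
        ≈⟨ +-congˡ (x∙yz≈y∙xz _ _ _) ⟩
      A zero k * laplace (minor B k) + t * (A zero k * laplace (minor C k))
        ≈⟨ +-cong (*-congʳ (A≈B zero k k≢c)) (*-congˡ (*-congʳ (A≈C zero k k≢c))) ⟩
      B zero k * laplace (minor B k) + t * (C zero k * laplace (minor C k)) ∎
      where
      avoids : ∀ j → j ≢ punchOut k≢c → punchIn k j ≢ c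
      avoids j j≢ eq = j≢ (punchIn-injective k _ _ (≡.trans eq (≡.sym (punchIn-punchOut k≢c))))

  -- The terms for c and c + 1 have equal entries and equal minors but opposite signs. Every other
  -- minor still contains both columns as neighbours, so it vanishes by induction.
  laplace-adjacent : ∀ {n} (c : Fin n) (A : Fin (suc n) → Fin (suc n) → Carrier) →
                     (∀ i → A i (inject₁ c) ≈ A i (suc c)) → laplace A ≈ 0#
  laplace-adjacent {suc n} c A eq = alternatingSum-adjacent c {summand A}
    (*-cong (eq zero) (laplace-cong λ i j → minors i j))
    λ k p q → trans (*-congˡ (vanish k p q)) (zeroʳ (A zero k))
    where
    minors : ∀ i j → minor A (inject₁ c) i j ≈ minor A (suc c) i j
    minors i j with punchIn-adjacent c j
    ... | inj₁ eq′ = reflexive (≡.cong (A (suc i)) eq′)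
    ... | inj₂ (p , q) = begin
      A (suc i) (punchIn (inject₁ c) j)  ≡⟨ ≡.cong (A (suc i)) p ⟩
      A (suc i) (suc c)                  ≈⟨ eq (suc i) ⟨
      A (suc i) (inject₁ c)              ≡⟨ ≡.cong (A (suc i)) q ⟨
      A (suc i) (punchIn (suc c) j)      ∎
    vanish : ∀ k → k ≢ inject₁ c → k ≢ suc c → laplace (minor A k) ≈ 0#
    vanish k p q with c′ , eq₁ , eq₂ ← punchIn-adjacent⁻ c k p q =
      laplace-adjacent c′ (minor A k) λ i → begin
        A (suc i) (punchIn k (inject₁ c′))  ≡⟨ ≡.cong (A (suc i)) eq₁ ⟩
        A (suc i) (inject₁ c)               ≈⟨ eq (suc i) ⟩
        A (suc i) (suc c)                   ≡⟨ ≡.cong (A (suc i)) eq₂ ⟨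
        A (suc i) (punchIn k (suc c′))      ∎

  -- The last row survives, still zero, in every minor until it is itself the row of expansion.
  laplace-zeroRow : ∀ {n} (A : Fin (suc n) → Fin (suc n) → Carrier) →
                    (∀ j → A (fromℕ n) j ≈ 0#) → laplace A ≈ 0#
  laplace-zeroRow {zero}  A A≈0 = alternatingSum-0 {f = summand A} λ { zero → trans (*-congʳ (A≈0 zero)) (zeroˡ _) }
  laplace-zeroRow {suc n} A A≈0 = alternatingSum-0 {f = summand A} λ k →
    trans (*-congˡ (laplace-zeroRow (minor A k) λ j → A≈0 (punchIn k j))) (zeroʳ (A zero k))

  -- Since the expansion runs along the first row, this goes by induction. The term that deletes the
  -- last column has a minor with zero last row. Every other minor keeps the corner as its own
  -- corner, so the corner factors out with no sign and leaves the expansion of the upper left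
  -- block.
  laplace-lastRow : ∀ {n} (A : Fin (suc n) → Fin (suc n) → Carrier) →
                    (∀ j → A (fromℕ n) (inject₁ j) ≈ 0#) →
                    laplace A ≈ A (fromℕ n) (fromℕ n) * laplace (λ i j → A (inject₁ i) (inject₁ j))
  laplace-lastRow {zero}  A A≈0 = trans (+-congˡ -0#≈0#) (+-identityʳ _)
  laplace-lastRow {suc n} A A≈0 = begin
    alternatingSum (summand A)
      ≈⟨ alternatingSum-init {f = summand A} (trans (*-congˡ lastMinor≈0) (zeroʳ _)) ⟩
    alternatingSum (summand A ∘ inject₁)
      ≈⟨ alternatingSum-cong term ⟩
    alternatingSum (λ k → x * summand A′ k)
      ≈⟨ alternatingSum-* x (summand A′) ⟨
    x * laplace A′ ∎
    where
    x = A (fromℕ (suc n)) (fromℕ (suc n))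
    A′ : Fin (suc n) → Fin (suc n) → Carrier
    A′ i j = A (inject₁ i) (inject₁ j)
    lastMinor≈0 : laplace (minor A (fromℕ (suc n))) ≈ 0#
    lastMinor≈0 = laplace-zeroRow (minor A (fromℕ (suc n))) λ j →
      trans (reflexive (≡.cong (A (fromℕ (suc n))) (punchIn-fromℕ j))) (A≈0 j)
    term : ∀ k → summand A (inject₁ k) ≈ x * summand A′ k
    term k = begin
      A zero (inject₁ k) * laplace (minor A (inject₁ k))
        ≈⟨ *-congˡ (laplace-lastRow (minor A (inject₁ k)) λ j →
             trans (reflexive (≡.cong (A (fromℕ (suc n))) (punchIn-inject₁ k j))) (A≈0 (punchIn k j))) ⟩
      A zero (inject₁ k) * (A (fromℕ (suc n)) (punchIn (inject₁ k) (fromℕ n)) *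
        laplace (λ i j → A (suc (inject₁ i)) (punchIn (inject₁ k) (inject₁ j))))
        ≈⟨ *-congˡ (*-cong (reflexive (≡.cong (A (fromℕ (suc n))) (punchIn-inject₁-fromℕ k)))
             (laplace-cong λ i j → reflexive (≡.cong (A (suc (inject₁ i))) (punchIn-inject₁ k j)))) ⟩
      A zero (inject₁ k) * (x * laplace (minor A′ k))
        ≈⟨ x∙yz≈y∙xz _ _ _ ⟩
      x * summand A′ k ∎

  -- Subtracting a multiple of the next column.

  module _ {n} t (u v : Fin (suc n) → ℕ → Carrier) (v≈u+tv : ∀ i k → v i k ≈ u i k + t * v i (suc k)) where

    private
      M : ℕ → Fin (suc n) → Fin (suc n) → Carrier
      M k i j = mixed (u i) (v i) k (toℕ j)

    -- Column c splits as its `u` part plus t times the `v` column of index c + 1. Linearity leaves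
    -- an error term `N` with that `v` column in position c. Position c + 1, not yet replaced, holds
    -- the same column, so the error vanishes.
    laplace-column-step : ∀ (c : Fin n) → laplace (M (toℕ c)) ≈ laplace (M (suc (toℕ c)))
    laplace-column-step c = begin
      laplace (M k)
        ≈⟨ laplace-linear (inject₁ c) t column
             (λ i j j≢ → reflexive (off i j j≢))
             (λ i j j≢ → reflexive (≡.trans (off i j j≢)
                           (≡.sym (updateAt-minimal j (inject₁ c) {const (v i (suc k))} (M (suc k) i) j≢)))) ⟩
      laplace (M (suc k)) + t * laplace N  ≈⟨ +-congˡ (trans (*-congˡ N≈0) (zeroʳ t)) ⟩
      laplace (M (suc k)) + 0#             ≈⟨ +-identityʳ _ ⟩
      laplace (M (suc k))                  ∎
      where
      k = toℕ c
      N : Fin (suc n) → Fin (suc n) → Carrier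
      N i = updateAt (M (suc k) i) (inject₁ c) (const (v i (suc k)))
      N-c : ∀ i → N i (inject₁ c) ≡ v i (suc k)
      N-c i = updateAt-updates (inject₁ c) {const (v i (suc k))} (M (suc k) i)
      off : ∀ i j → j ≢ inject₁ c → M k i j ≡ M (suc k) i j
      off i j j≢ = mixed-suc (u i) (v i) k (toℕ j) λ eq →
        j≢ (toℕ-injective (≡.trans eq (≡.sym (toℕ-inject₁ c))))
      column : ∀ i → M k i (inject₁ c) ≈ M (suc k) i (inject₁ c) + t * N i (inject₁ c)
      column i rewrite N-c i | toℕ-inject₁ c | mixed-diagonal (u i) (v i) k
                     | mixed-suc-diagonal (u i) (v i) k = v≈u+tv i k
      N≈0 : laplace N ≈ 0#
      N≈0 = laplace-adjacent c N λ i → reflexive (≡.trans (N-c i) (≡.sym (≡.trans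
        (updateAt-minimal (suc c) (inject₁ c) {const (v i (suc k))} (M (suc k) i) (inject₁≢suc c ∘ ≡.sym))
        (mixed-diagonal (u i) (v i) (suc k)))))

    -- Columns are replaced from left to right, so the right neighbour of the current one is always
    -- untouched. The bound n spares the last column, which has no right neighbour.
    laplace-columns : ∀ k → k ℕ.≤ n → laplace (M 0) ≈ laplace (M k)
    laplace-columns zero    _   = refl
    laplace-columns (suc k) k<n = trans (laplace-columns k (ℕ.<⇒≤ k<n))
      (≡.subst (λ l → laplace (M l) ≈ laplace (M (suc l))) (toℕ-fromℕ< k<n)
        (laplace-column-step (fromℕ< k<n)))

-- The Leibniz formula agrees with the Laplace expansion.

module DeterminantExpansion {c ℓ} (R : CommutativeRing c ℓ) where
  open CommutativeRing R hiding (zero)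
  open OverRing R
  open Laplace R
  open RingProperties ring using (-1*x≈-x)
  open Exp semiring using (_^_; ^-congʳ; ^-homo-*)
  open CommutativeSemigroup *-commutativeSemigroup using (interchange)
  open ≈-Reasoning setoid

  module _ {a} {A : Set a} where

    sumOver-cong : ∀ (xs : List A) {f g} → (∀ x → f x ≈ g x) → sumOver xs f ≈ sumOver xs g
    sumOver-cong []       f≈g = refl
    sumOver-cong (x ∷ xs) f≈g = +-cong (f≈g x) (sumOver-cong xs f≈g)

    sumOver-map : ∀ {b} {B : Set b} (g : A → B) xs f → sumOver (map g xs) f ≡ sumOver xs (f ∘ g)
    sumOver-map g xs f = ≡.cong (List.foldr _+_ 0#) (≡.sym (map-∘ xs))

    sumOver-++ : ∀ (xs ys : List A) f → sumOver (xs ++ ys) f ≈ sumOver xs f + sumOver ys f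
    sumOver-++ []       ys f = sym (+-identityˡ _)
    sumOver-++ (x ∷ xs) ys f = trans (+-congˡ (sumOver-++ xs ys f)) (sym (+-assoc _ _ _))

  module _ {a} {A : Set a} where

    sumOver-* : ∀ (xs : List A) t f → t * sumOver xs f ≈ sumOver xs (λ x → t * f x)
    sumOver-* []       t f = zeroʳ t
    sumOver-* (x ∷ xs) t f = trans (distribˡ t _ _) (+-congˡ (sumOver-* xs t f))

    sumOver-alternatingSum : ∀ (xs : List A) {n} (f : Fin n → A → Carrier) →
                             alternatingSum (λ k → sumOver xs (f k)) ≈
                             sumOver xs (λ x → alternatingSum (λ k → f k x))
    sumOver-alternatingSum []       {n} f = alternatingSum-0 {n} λ _ → refl
    sumOver-alternatingSum (x ∷ xs) f =
      trans (alternatingSum-+ (λ k → f k x) (λ k → sumOver xs (f k))) (+-congˡ (sumOver-alternatingSum xs f))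

    sumOver-concatMap : ∀ {b} {B : Set b} (g : A → List B) xs f →
                        sumOver (concatMap g xs) f ≈ sumOver xs (λ x → sumOver (g x) f)
    sumOver-concatMap g []       f = refl
    sumOver-concatMap g (x ∷ xs) f =
      trans (sumOver-++ (g x) (concatMap g xs) f) (+-congˡ (sumOver-concatMap g xs f))

    sumOver-cartesianProductWith : ∀ {b d} {B : Set b} {D : Set d} (g : A → B → D) xs ys f →
      sumOver (cartesianProductWith g xs ys) f ≈ sumOver xs (λ x → sumOver ys (f ∘ g x))
    sumOver-cartesianProductWith g []       ys f = refl
    sumOver-cartesianProductWith g (x ∷ xs) ys f =
      trans (sumOver-++ (map (g x) ys) _ f)
        (+-cong (reflexive (sumOver-map (g x) ys f))
                (sumOver-cartesianProductWith g xs ys f))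

  sumOver-allFin-suc : ∀ {n} (f : Fin (suc n) → Carrier) →
                       sumOver (allFin (suc n)) f ≡ f zero + sumOver (allFin n) (f ∘ suc)
  sumOver-allFin-suc f = ≡.cong (λ xs → f zero + List.foldr _+_ 0# xs)
    (≡.trans (map-tabulate suc f) (≡.sym (map-tabulate id (f ∘ suc))))

  -- Pulling one factor -1 out of the tail turns explicit powers into nested subtraction.
  sumOver-allFin-sign : ∀ {n} (f : Fin n → Carrier) →
                        sumOver (allFin n) (λ k → (- 1#) ^ toℕ k * f k) ≈ alternatingSum f
  sumOver-allFin-sign {zero}  f = refl
  sumOver-allFin-sign {suc n} f = begin
    sumOver (allFin (suc n)) (λ k → (- 1#) ^ toℕ k * f k)
      ≡⟨ sumOver-allFin-suc (λ k → (- 1#) ^ toℕ k * f k) ⟩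
    1# * f zero + sumOver (allFin n) (λ k → - 1# * (- 1#) ^ toℕ k * f (suc k))
      ≈⟨ +-cong (*-identityˡ _) (sumOver-cong (allFin n) λ k → *-assoc _ _ _) ⟩
    f zero + sumOver (allFin n) (λ k → - 1# * ((- 1#) ^ toℕ k * f (suc k)))
      ≈⟨ +-congˡ (sumOver-* (allFin n) (- 1#) _) ⟨
    f zero + - 1# * sumOver (allFin n) (λ k → (- 1#) ^ toℕ k * f (suc k))
      ≈⟨ +-congˡ (trans (-1*x≈-x _) (-‿cong (sumOver-allFin-sign (f ∘ suc)))) ⟩
    alternatingSum f ∎

  sign-insert : ∀ {n} k (π : Permutation′ n) →
                sign (Perm.insert zero k π) ≈ (- 1#) ^ toℕ k * sign π
  sign-insert k π = trans (^-congʳ (- 1#) (inversions-insert k π)) (^-homo-* (- 1#) (toℕ k) _)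

  -- `permutations` already groups permutations by their value k at 0. Within a group, the sign
  -- splits off (-1)^k and the product splits off the entry of the first row; the rest is the
  -- Leibniz sum of a minor.
  det≈laplace : ∀ {n} (A : Fin n → Fin n → Carrier) → det A ≈ laplace A
  det≈laplace {zero}  A = trans (+-identityʳ _) (*-identityʳ 1#)
  det≈laplace {suc n} A = begin
    det A
      ≈⟨ sumOver-cartesianProductWith (Perm.insert zero) (allFin (suc n)) (permutations n) _ ⟩
    sumOver (allFin (suc n)) (λ k → sumOver (permutations n) λ π →
      sign (Perm.insert zero k π) * (A zero k * ∏ (λ i → minor A k i (π ⟨$⟩ʳ i))))
      ≈⟨ sumOver-cong (allFin (suc n)) (λ k → begin
           sumOver (permutations n) (λ π →
             sign (Perm.insert zero k π) * (A zero k * ∏ (λ i → minor A k i (π ⟨$⟩ʳ i))))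
             ≈⟨ sumOver-cong (permutations n) (λ π →
                  trans (*-congʳ (sign-insert k π)) (interchange _ _ _ _)) ⟩
           sumOver (permutations n) (λ π →
             (- 1#) ^ toℕ k * A zero k * (sign π * ∏ (λ i → minor A k i (π ⟨$⟩ʳ i))))
             ≈⟨ sumOver-* (permutations n) _ _ ⟨
           (- 1#) ^ toℕ k * A zero k * det (minor A k)
             ≈⟨ trans (*-assoc _ _ _) (*-congˡ (*-congˡ (det≈laplace (minor A k)))) ⟩
           (- 1#) ^ toℕ k * summand A k ∎) ⟩
    sumOver (allFin (suc n)) (λ k → (- 1#) ^ toℕ k * summand A k)
      ≈⟨ sumOver-allFin-sign (summand A) ⟩
    laplace A ∎
  s≈laplace : ∀ {n} (h : ℤ → Fin n → Carrier) {m} (m≤n : m ℕ.≤ n) (λs : Vec ℤ m)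
              {B : Fin m → Fin m → Carrier} →
              (∀ i j → h (lookup λs i ℤ.+ + toℕ j ℤ.- + toℕ i) (inject≤ i m≤n) ≈ B i j) →
              s h m≤n λs ≈ laplace B
  s≈laplace h m≤n λs eq = trans
    (det≈laplace λ i j → h (lookup λs i ℤ.+ + toℕ j ℤ.- + toℕ i) (inject≤ i m≤n))
    (laplace-cong eq)

-- The ring of formal power series.

module PowerSeries {c ℓ} (R : CommutativeRing c ℓ) where
  open CommutativeRing R hiding (zero)
  open OverRing R using (sumOver)
  open DeterminantExpansion R
  open Laplace R
  open CommutativeSemigroup +-commutativeSemigroup using (interchange)
  open ≈-Reasoning setoid

  constant : Carrier → ℕ → Carrier
  constant a zero    = a
  constant a (suc n) = 0#

  X : ℕ → Carrier
  X zero    = 0#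
  X (suc n) = constant 1# n

  infixl 7 _⊛_
  -- The Cauchy product, by recursion on the degree with the constant term of the left factor split
  -- off, so that the ring laws follow by induction.
  _⊛_ : (ℕ → Carrier) → (ℕ → Carrier) → ℕ → Carrier
  (f ⊛ g) zero    = f 0 * g 0
  (f ⊛ g) (suc n) = f 0 * g (suc n) + ((f ∘ suc) ⊛ g) n

  ⊛-cong : ∀ {f f′ g g′} → (∀ n → f n ≈ f′ n) → (∀ n → g n ≈ g′ n) → ∀ n → (f ⊛ g) n ≈ (f′ ⊛ g′) n
  ⊛-cong f≈ g≈ zero    = *-cong (f≈ 0) (g≈ 0)
  ⊛-cong f≈ g≈ (suc n) = +-cong (*-cong (f≈ 0) (g≈ (suc n))) (⊛-cong (f≈ ∘ suc) g≈ n)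

  -- The mirror image of the defining recursion; commutativity needs both.
  ⊛-sucʳ : ∀ f g n → (f ⊛ g) (suc n) ≈ (f ⊛ (g ∘ suc)) n + f (suc n) * g 0
  ⊛-sucʳ f g zero    = refl
  ⊛-sucʳ f g (suc n) = trans (+-congˡ (⊛-sucʳ (f ∘ suc) g n)) (sym (+-assoc _ _ _))

  ⊛-comm : ∀ f g n → (f ⊛ g) n ≈ (g ⊛ f) n
  ⊛-comm f g zero    = *-comm _ _
  ⊛-comm f g (suc n) = begin
    f 0 * g (suc n) + ((f ∘ suc) ⊛ g) n  ≈⟨ +-cong (*-comm _ _) (⊛-comm (f ∘ suc) g n) ⟩
    g (suc n) * f 0 + (g ⊛ (f ∘ suc)) n  ≈⟨ +-comm _ _ ⟩
    (g ⊛ (f ∘ suc)) n + g (suc n) * f 0  ≈⟨ ⊛-sucʳ g f n ⟨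
    (g ⊛ f) (suc n)                      ∎

  ⊛-distribʳ-+ : ∀ h f g n → ((λ k → f k + g k) ⊛ h) n ≈ (f ⊛ h) n + (g ⊛ h) n
  ⊛-distribʳ-+ h f g zero    = distribʳ _ _ _
  ⊛-distribʳ-+ h f g (suc n) =
    trans (+-cong (distribʳ _ _ _) (⊛-distribʳ-+ h (f ∘ suc) (g ∘ suc) n)) (interchange _ _ _ _)

  ⊛-scaleˡ : ∀ a f g n → ((λ k → a * f k) ⊛ g) n ≈ a * (f ⊛ g) n
  ⊛-scaleˡ a f g zero    = *-assoc _ _ _
  ⊛-scaleˡ a f g (suc n) =
    trans (+-cong (*-assoc _ _ _) (⊛-scaleˡ a (f ∘ suc) g n)) (sym (distribˡ _ _ _))

  ⊛-assoc : ∀ f g h n → ((f ⊛ g) ⊛ h) n ≈ (f ⊛ (g ⊛ h)) n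
  ⊛-assoc f g h zero    = *-assoc _ _ _
  ⊛-assoc f g h (suc n) = begin
    f 0 * g 0 * h (suc n) + ((λ k → f 0 * g (suc k) + ((f ∘ suc) ⊛ g) k) ⊛ h) n
      ≈⟨ +-cong (*-assoc _ _ _) (⊛-distribʳ-+ h (λ k → f 0 * g (suc k)) ((f ∘ suc) ⊛ g) n) ⟩
    f 0 * (g 0 * h (suc n)) + (((λ k → f 0 * g (suc k)) ⊛ h) n + (((f ∘ suc) ⊛ g) ⊛ h) n)
      ≈⟨ +-congˡ (+-cong (⊛-scaleˡ (f 0) (g ∘ suc) h n) (⊛-assoc (f ∘ suc) g h n)) ⟩
    f 0 * (g 0 * h (suc n)) + (f 0 * ((g ∘ suc) ⊛ h) n + ((f ∘ suc) ⊛ (g ⊛ h)) n)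
      ≈⟨ +-assoc _ _ _ ⟨
    f 0 * (g 0 * h (suc n)) + f 0 * ((g ∘ suc) ⊛ h) n + ((f ∘ suc) ⊛ (g ⊛ h)) n
      ≈⟨ +-congʳ (distribˡ _ _ _) ⟨
    (f ⊛ (g ⊛ h)) (suc n) ∎

  ⊛-zeroˡ : ∀ g n → ((λ _ → 0#) ⊛ g) n ≈ 0#
  ⊛-zeroˡ g zero    = zeroˡ _
  ⊛-zeroˡ g (suc n) = trans (+-cong (zeroˡ _) (⊛-zeroˡ g n)) (+-identityʳ 0#)

  constant-⊛ : ∀ a g n → (constant a ⊛ g) n ≈ a * g n
  constant-⊛ a g zero    = refl
  constant-⊛ a g (suc n) = trans (+-congˡ (⊛-zeroˡ g n)) (+-identityʳ _)

  ⊛-identityˡ : ∀ g n → (constant 1# ⊛ g) n ≈ g n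
  ⊛-identityˡ g n = trans (constant-⊛ 1# g n) (*-identityˡ _)

  -- Packaged as a ring so that the determinant lemmas of `Laplace` apply to matrices of series.
  powerSeries : CommutativeRing c ℓ
  powerSeries = record
    { isCommutativeRing = record
      { isRing = record
        { +-isAbelianGroup = AbelianGroup.isAbelianGroup seriesGroup
        ; *-cong           = ⊛-cong
        ; *-assoc          = ⊛-assoc
        ; *-identity       = comm∧idˡ⇒id ⊛-comm ⊛-identityˡ
        ; distrib          = comm∧distrʳ⇒distr
                               (AbelianGroup.∙-cong seriesGroup) ⊛-comm ⊛-distribʳ-+
        }
      ; *-comm = ⊛-comm
      }
    }
    where
    seriesGroup = Pointwise.abelianGroup ℕ +-abelianGroup
    open Consequences (AbelianGroup.setoid seriesGroup)

  module K = Laplace powerSeries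

  -- Coefficients of determinants of series.

  alternatingSum-coefficient : ∀ {n} (f : Fin n → ℕ → Carrier) p →
                               K.alternatingSum f p ≡ alternatingSum (λ k → f k p)
  alternatingSum-coefficient {zero}  f zero    = ≡.refl
  alternatingSum-coefficient {zero}  f (suc p) = ≡.refl
  alternatingSum-coefficient {suc n} f p       =
    ≡.cong (λ x → f zero p - x) (alternatingSum-coefficient (f ∘ suc) p)

  laplace-constant : ∀ {n} (A : Fin n → Fin n → Carrier) p →
                     K.laplace (λ i j → constant (A i j)) p ≈ constant (laplace A) p
  laplace-constant {zero}  A p = refl
  laplace-constant {suc n} A p = begin
    K.laplace (λ i j → constant (A i j)) p
      ≡⟨ alternatingSum-coefficient (K.summand λ i j → constant (A i j)) p ⟩
    alternatingSum (λ k → (constant (A zero k) ⊛ K.laplace (λ i j → constant (minor A k i j))) p)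
      ≈⟨ alternatingSum-cong (λ k → trans (constant-⊛ (A zero k) (K.laplace λ i j → constant (minor A k i j)) p)
                                          (*-congˡ (laplace-constant (minor A k) p))) ⟩
    alternatingSum (λ k → A zero k * constant (laplace (minor A k)) p)
      ≈⟨ collect p ⟩
    constant (laplace A) p ∎
    where
    collect : ∀ p → alternatingSum (λ k → A zero k * constant (laplace (minor A k)) p) ≈
                    constant (laplace A) p
    collect zero    = refl
    collect (suc p) = alternatingSum-0 λ k → zeroʳ (A zero k)

  -- This form matches the recursion of `weakCompositions`, which picks the first part b and then
  -- composes p - b.
  ⊛-coefficient : ∀ f g p → (f ⊛ g) p ≈ sumOver (upTo (suc p)) (λ b → f b * g (p ∸ b))
  ⊛-coefficient f g zero    = sym (+-identityʳ _)
  ⊛-coefficient f g (suc p) = +-congˡ (begin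
    ((f ∘ suc) ⊛ g) p
      ≈⟨ ⊛-coefficient (f ∘ suc) g p ⟩
    sumOver (upTo (suc p)) (λ b → f (suc b) * g (p ∸ b))
      ≡⟨ sumOver-map suc (upTo (suc p)) (λ b → f b * g (suc p ∸ b)) ⟨
    sumOver (map suc (upTo (suc p))) (λ b → f b * g (suc p ∸ b))
      ≡⟨ ≡.cong (λ xs → sumOver xs (λ b → f b * g (suc p ∸ b))) (map-upTo suc (suc p)) ⟩
    sumOver (applyUpTo suc (suc p)) (λ b → f b * g (suc p ∸ b)) ∎)

  -- Multilinearity in the rows: each row i contributes one power of t, with exponent β i, and the
  -- exponents must add up to p. The expansion picks the exponent b of the first row and leaves p -
  -- b to the minors. With no rows, the determinant 1 has only a constant term, matching the empty
  -- tuple of sum 0.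
  laplace-coefficient : ∀ {n} (A : Fin n → Fin n → ℕ → Carrier) p →
    K.laplace A p ≈ sumOver (weakCompositions n p) (λ β → laplace (λ i j → A i j (lookup β i)))
  laplace-coefficient {zero}  A zero    = sym (+-identityʳ 1#)
  laplace-coefficient {zero}  A (suc p) = refl
  laplace-coefficient {suc n} A p       = begin
    K.laplace A p
      ≡⟨ alternatingSum-coefficient (K.summand A) p ⟩
    alternatingSum (λ k → (A zero k ⊛ K.laplace (K.minor A k)) p)
      ≈⟨ alternatingSum-cong (λ k → trans (⊛-coefficient (A zero k) (K.laplace (K.minor A k)) p)
           (sumOver-cong (upTo (suc p)) λ b →
             trans (*-congˡ (laplace-coefficient (K.minor A k) (p ∸ b)))
                   (sumOver-* (weakCompositions n (p ∸ b)) _ (λ γ → laplace (λ i j → A (suc i) (punchIn k j) (lookup γ i)))))) ⟩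
    alternatingSum (λ k → sumOver (upTo (suc p)) λ b → sumOver (weakCompositions n (p ∸ b)) λ γ →
      term b γ k)
      -- The sum over columns k moves innermost, past b and then past γ, where it reassembles the
      -- determinant `D (b ∷ γ)`.
      ≈⟨ sumOver-alternatingSum (upTo (suc p))
           (λ k b → sumOver (weakCompositions n (p ∸ b)) λ γ → term b γ k) ⟩
    sumOver (upTo (suc p)) (λ b → alternatingSum λ k → sumOver (weakCompositions n (p ∸ b)) λ γ →
      term b γ k)
      ≈⟨ sumOver-cong (upTo (suc p)) (λ b →
           sumOver-alternatingSum (weakCompositions n (p ∸ b)) (λ k γ → term b γ k)) ⟩
    sumOver (upTo (suc p)) (λ b → sumOver (weakCompositions n (p ∸ b)) λ γ → D (b ∷ γ))
      ≈⟨ sumOver-cong (upTo (suc p)) (λ b →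
           reflexive (≡.sym (sumOver-map (b ∷_) (weakCompositions n (p ∸ b)) D))) ⟩
    sumOver (upTo (suc p)) (λ b → sumOver (map (b ∷_) (weakCompositions n (p ∸ b))) D)
      ≈⟨ sumOver-concatMap (λ b → map (b ∷_) (weakCompositions n (p ∸ b))) (upTo (suc p)) D ⟨
    sumOver (weakCompositions (suc n) p) D ∎
    where
    D : Vec ℕ (suc n) → Carrier
    D β = laplace (λ i j → A i j (lookup β i))
    term : ℕ → Vec ℕ n → Fin (suc n) → Carrier
    term b γ k = A zero k b * laplace (λ i j → A (suc i) (punchIn k j) (lookup γ i))

  -- A series is its constant term plus t times its tail; this supplies the column relation that
  -- `laplace-columns` requires.
  shift : ∀ f n → f n ≈ constant (f 0) n + (X ⊛ (f ∘ suc)) n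
  shift f zero    = sym (trans (+-congˡ (zeroˡ _)) (+-identityʳ _))
  shift f (suc n) = sym (begin
    0# + (0# * f (suc (suc n)) + (constant 1# ⊛ (f ∘ suc)) n)
      ≈⟨ +-identityˡ _ ⟩
    0# * f (suc (suc n)) + (constant 1# ⊛ (f ∘ suc)) n
      ≈⟨ +-cong (zeroˡ _) (⊛-identityˡ (f ∘ suc) n) ⟩
    0# + f (suc n)
      ≈⟨ +-identityˡ _ ⟩
    f (suc n) ∎)

  -- The core identity, for arbitrary sequences as rows. The vanishing assumption clears the last
  -- row up to its corner once the earlier columns are constant.
  sum-laplace : ∀ {n} (f : Fin (suc n) → ℕ → Carrier) p →
    (∀ (j : Fin n) → f (fromℕ n) (toℕ j) ≈ 0#) →
    sumOver (weakCompositions (suc n) p) (λ β → laplace λ i j → f i (toℕ j ℕ.+ lookup β i)) ≈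
    f (fromℕ n) (n ℕ.+ p) * laplace (λ i j → f (inject₁ i) (toℕ j))
  sum-laplace {n} f p f≈0 = begin
    sumOver (weakCompositions (suc n) p) (λ β → laplace λ i j → f i (toℕ j ℕ.+ lookup β i))
      ≈⟨ laplace-coefficient (λ i j → v i (toℕ j)) p ⟨
    K.laplace (λ i j → v i (toℕ j)) p
      ≈⟨ K.laplace-columns X u v v≈u+Xv n ≤-refl p ⟩
    K.laplace M p
      ≈⟨ K.laplace-lastRow M lastRow p ⟩
    (M (fromℕ n) (fromℕ n) ⊛ K.laplace (λ i j → M (inject₁ i) (inject₁ j))) p
      -- The corner is still a full series, but the block that it multiplies has constant entries
      -- and hence a constant determinant.
      ≈⟨ ⊛-cong corner (λ q → trans
           (K.laplace-cong (λ i j q → reflexive (≡.cong (_$ q) (M-inject₁ (inject₁ i) j))) q)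
           (laplace-constant A q)) p ⟩
    (v (fromℕ n) n ⊛ constant (laplace A)) p
      ≈⟨ ⊛-comm (v (fromℕ n) n) (constant (laplace A)) p ⟩
    (constant (laplace A) ⊛ v (fromℕ n) n) p
      ≈⟨ constant-⊛ (laplace A) (v (fromℕ n) n) p ⟩
    laplace A * f (fromℕ n) (n ℕ.+ p)
      ≈⟨ *-comm _ _ ⟩
    f (fromℕ n) (n ℕ.+ p) * laplace A ∎
    where
    A : Fin n → Fin n → Carrier
    A i j = f (inject₁ i) (toℕ j)
    -- `v i j` is the series in row i and column j of the original matrix, and `u i j` is its
    -- constant term.
    u v : Fin (suc n) → ℕ → ℕ → Carrier
    u i k = constant (f i k)
    v i k b = f i (k ℕ.+ b)
    M : Fin (suc n) → Fin (suc n) → ℕ → Carrier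
    M i j = mixed (u i) (v i) n (toℕ j)
    v≈u+Xv : ∀ i k b → v i k b ≈ u i k b + (X ⊛ v i (suc k)) b
    v≈u+Xv i k b = trans (shift (v i k) b) (+-cong
      (reflexive (≡.cong (λ l → constant (f i l) b) (ℕ.+-identityʳ k)))
      (⊛-cong (λ _ → refl) (λ q → reflexive (≡.cong (f i) (ℕ.+-suc k q))) b))
    M-inject₁ : ∀ i j → M i (inject₁ j) ≡ u i (toℕ j)
    M-inject₁ i j = ≡.trans (≡.cong (mixed (u i) (v i) n) (toℕ-inject₁ j)) (mixed-< (u i) (v i) j)
    lastRow : ∀ j q → M (fromℕ n) (inject₁ j) q ≈ 0#
    lastRow j q rewrite M-inject₁ (fromℕ n) j = constant≈0 q
      where
      constant≈0 : ∀ q → constant (f (fromℕ n) (toℕ j)) q ≈ 0#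
      constant≈0 zero    = f≈0 j
      constant≈0 (suc q) = refl
    corner : ∀ q → M (fromℕ n) (fromℕ n) q ≈ v (fromℕ n) n q
    corner q = reflexive (≡.cong (_$ q) (≡.trans
      (≡.cong (mixed (u (fromℕ n)) (v (fromℕ n)) n) (toℕ-fromℕ n))
      (mixed-diagonal (u (fromℕ n)) (v (fromℕ n)) n)))

-- Specialisation to the determinants `s`.

lookup-init : ∀ {a} {A : Set a} {n} (xs : Vec A (suc n)) i → lookup (init xs) i ≡ lookup xs (inject₁ i)
lookup-init (x ∷ y ∷ xs) zero    = ≡.refl
lookup-init (x ∷ y ∷ xs) (suc i) = lookup-init (y ∷ xs) i

lookup-fromℕ : ∀ {a} {A : Set a} {n} (xs : Vec A (suc n)) → lookup xs (fromℕ n) ≡ last xs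
lookup-fromℕ (x ∷ [])     = ≡.refl
lookup-fromℕ (x ∷ y ∷ xs) = lookup-fromℕ (y ∷ xs)

inject≤≡inject₁ : ∀ {n} (i : Fin n) .(le : n ℕ.≤ suc n) → inject≤ i le ≡ inject₁ i
inject≤≡inject₁ zero    le = ≡.refl
inject≤≡inject₁ (suc i) le = ≡.cong suc (inject≤≡inject₁ i _)

corollary3p6 : ∀ {c ℓ} (R : CommutativeRing c ℓ) →
    let open CommutativeRing R
        open OverRing R
    in
    (n-1 : ℕ) → let n = suc n-1 in
    (p : ℤ)
    (h : ℤ → Fin n → Carrier) →
    (∀ k → k < 0ℤ → h k (fromℕ n-1) ≈ 0#) →
    (μ : Vec ℤ n) → last μ ≡ 0ℤ →
    h p (fromℕ n-1) * s h (n≤1+n n-1) (init μ)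
      ≈ ∑[ β ∈ weakCompositionsℤ n p ] s h ≤-refl (μ ⊕ β)
-- For negative p the right-hand side is an empty sum, and the left-hand side has a vanishing
-- factor.
corollary3p6 R n-1 -[1+ p ] h h≈0 μ μₙ≡0 = trans (*-congʳ (h≈0 -[1+ p ] ℤ.-<+)) (zeroˡ _)
  where open CommutativeRing R
corollary3p6 R n-1 (+ p) h h≈0 μ μₙ≡0 = sym (begin
  sumOver (weakCompositions n p) (λ β → s h ≤-refl (μ ⊕ β))
    ≈⟨ sumOver-cong (weakCompositions n p) (λ β → s≈laplace h ≤-refl (μ ⊕ β) λ i j →
         reflexive (≡.cong₂ h (index β i j) (inject≤-refl i ≤-refl))) ⟩
  sumOver (weakCompositions n p) (λ β → laplace λ i j → f i (toℕ j ℕ.+ lookup β i))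
    -- As the last entry of μ is 0, the last row has `h` at the indices j - `n-1`, which are
    -- negative left of the corner.
    ≈⟨ sum-laplace f p (λ j → trans (reflexive (f-last (toℕ j)))
         (h≈0 _ (negative j))) ⟩
  f (fromℕ n-1) (n-1 ℕ.+ p) * laplace (λ i j → f (inject₁ i) (toℕ j))
    -- At the corner the column index `n-1` cancels the equal row index, leaving `h` at p.
    ≈⟨ *-cong
         (reflexive (≡.trans (f-last (n-1 ℕ.+ p)) (≡.cong (λ k → h k (fromℕ n-1)) (cancel (+ n-1) (+ p)))))
         (sym (s≈laplace h (n≤1+n n-1) (init μ) λ i j → reflexive (≡.cong₂ h
           (≡.cong₂ (λ x y → x ℤ.+ + toℕ j ℤ.- + y) (lookup-init μ i) (≡.sym (toℕ-inject₁ i)))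
           (inject≤≡inject₁ i (n≤1+n n-1))))) ⟩
  h (+ p) (fromℕ n-1) * s h (n≤1+n n-1) (init μ) ∎)
  where
  open CommutativeRing R
  open OverRing R
  open Laplace R
  open DeterminantExpansion R
  open PowerSeries R using (sum-laplace)
  open ≈-Reasoning setoid
  n = suc n-1
  -- Adding β to μ shifts row i by β i columns, so every entry on the right-hand side is a value of
  -- this one `f`.
  f : Fin n → ℕ → Carrier
  f i k = h (lookup μ i ℤ.+ + k ℤ.- + toℕ i) i
  f-last : ∀ k → f (fromℕ n-1) k ≡ h (+ k ℤ.- + n-1) (fromℕ n-1)
  f-last k = ≡.cong (λ l → h l (fromℕ n-1)) (≡.cong₂ ℤ._-_
    (≡.trans (≡.cong (λ x → x ℤ.+ + k) (≡.trans (lookup-fromℕ μ) μₙ≡0)) (ℤ.+-identityˡ (+ k)))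
    (≡.cong +_ (toℕ-fromℕ n-1)))
  negative : ∀ (j : Fin n-1) → + toℕ j ℤ.- + n-1 < 0ℤ
  negative j = ≡.subst (+ toℕ j ℤ.- + n-1 <_) (ℤ.+-inverseʳ (+ n-1))
    (ℤ.+-monoˡ-< (ℤ.- + n-1) (ℤ.+<+ (toℕ<n j)))
  cancel : ∀ x y → x ℤ.+ y ℤ.- x ≡ y
  cancel = ℤSolver.solve-∀
  index : ∀ β i j → lookup (μ ⊕ β) i ℤ.+ + toℕ j ℤ.- + toℕ i ≡
                    lookup μ i ℤ.+ + (toℕ j ℕ.+ lookup β i) ℤ.- + toℕ i
  index β i j = ≡.cong (λ k → k ℤ.- + toℕ i) (≡.trans
    (≡.cong (λ k → k ℤ.+ + toℕ j) (lookup-zipWith _ i μ β))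
    (≡.trans (ℤ.+-assoc (lookup μ i) _ _)
             (≡.cong (λ k → lookup μ i ℤ.+ k) (ℤ.+-comm (+ lookup β i) (+ toℕ j)))))
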